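{- There is a P/T system underlying any PEPA model, namely $\langle\mathcal{N},\mathbf{m}_0\rangle$, where $\mathbf{m}_0$ is the starting state of the model (in numerical vector form) and $\mathcal{N}=(\mathcal{D},\mathcal{A}_{\mathrm{label}},\mathbf{C}^{\mathrm{Pre}},\mathbf{C}^{\mathrm{Post}})$ is a P/T net, where $\mathcal{D}$ is the set of local derivatives, $\mathcal{A}_{\mathrm{label}}$ is the set of labelled activities, and $\mathbf{C}^{\mathrm{Pre}}$ and $\mathbf{C}^{\mathrm{Post}}$ are the pre and post activity matrices respectively. Moreover, each state $\mathbf{m}$ of the PEPA model is a marking of $\mathcal{N}$.
   Context: Petri net notions. A Place/Transition net (P/T net) is a structure $\mathcal{N}=(P,T,\mathbf{Pre},\mathbf{Post})$ where $P$ and $T$ are the sets of places and transitions respectively, and $\mathbf{Pre}$ and $\mathbf{Post}$ are $|P|\times|T|$ matrices with natural number entries (incidence matrices). A marking is a vector $\mathbf{m}:P\to\mathbb{N}$ assigning to each place a nonnegative integer. A P/T system is a pair $\langle\mathcal{N},\mathbf{m}_0\rangle$ of a P/T net $\mathcal{N}$ and an initial marking $\mathbf{m}_0$. PEPA notions. A PEPA model is a parallel composition (with cooperation over sets of action types) of finitely many sequential components, each belonging to one of finitely many component types; each type has finitely many local derivatives (local states of a single sequential component). $\mathcal{D}$ denotes the finite set of all local derivatives of all component types. Sequential components have transitions $U\stackrel{l}{\longrightarrow}V$ with $U,V\in\mathcal{D}$ of the same type and $l$ an activity; there are finitely many activities, and each is either individual (performed by one component alone) or shared (synchronised). Numerical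 vector form: a state of the model is the vector $\mathbf{m}$ indexed by $\mathcal{D}$ whose entry $\mathbf{m}[U]$ is the number of sequential components currently in local derivative $U$. For an activity $l$, $\mathrm{pre}(l)$ is the set of local derivatives $U$ that can enable $l$, i.e. $U\stackrel{l}{\longrightarrow}V$ for some $V$; and $\mathrm{post}(U,l)=\{V\mid U\stackrel{l}{\longrightarrow}V\}$. For a shared activity $l$, the elements of $\mathrm{pre}(l)$ belong to distinct component types; write $\mathrm{pre}(l)=\{U_1,\dots,U_k\}$. Labelled activities: (1) for an individual activity $l$, for each $U\in\mathrm{pre}(l)$ and $V\in\mathrm{post}(U,l)$ there is a labelled activity $l^{U\to V}$, with $\mathrm{pre}(l^{U\to V})=\{U\}$ and $\mathrm{post}(l^{U\to V})=\{V\}$; (2) for a shared activity $l$ with $\mathrm{pre}(l)=\{U_1,\dots,U_k\}$, for each $(V_1,\dots,V_k)\in\mathrm{post}(U_1,l)\times\cdots\times\mathrm{post}(U_k,l)$ there is a labelled activity $l^{w}$ with $w=(U_1\to V_1,\dots,U_k\to V_k)$, with $\mathrm{pre}(l^w)=\mathrm{pre}(l)$ and $\mathrm{post}(l^w)=\{V_1,\dots,V_k\}$. $\mathcal{A}_{\mathrm{label}}$ is the set of all labelled activities. Pre and post activity matrices: the $|\mathcal{D}|\times|\mathcal{A}_{\mathrm{label}}|$ matrices given, for $U\in\mathcal{D}$ and $a\in\mathcal{A}_{\mathrm{label}}$, by $\mathbf{C}^{\mathrm{Pre}}(U,a)=1$ if $U\in\mathrm{pre}(a)$ and $0$ otherwise,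 and $\mathbf{C}^{\mathrm{Post}}(U,a)=1$ if $U\in\mathrm{post}(a)$ and $0$ otherwise. -}

module Defs where

open import Data.Bool using (Bool; T; if_then_else_)
open import Data.Bool.Properties using (T?)
open import Data.Fin using (Fin)
open import Data.Fin.Properties using (_≟_; any?)
open import Data.Fin.Subset using (Subset; _∈_; _∉_; _∪_) renaming (⊥ to ∅)
open import Data.List using (List; [_]; _++_; allFin; filter; length)
open import Data.List.Relation.Unary.All as All using (All)
open import Data.Nat using (ℕ)
open import Data.Product using (∃; ∃-syntax; _×_; _,_; proj₁)
open import Function.Bundles using (_↔_)
open import Relation.Binary.Construct.Closure.ReflexiveTransitive using (Star)
open import Relation.Binary.PropositionalEquality using (_≡_; _≗_; _≢_)
open import Relation.Nullary using (Dec; does)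
import Data.List.Membership.DecPropositional as DecMembership

Finite : Set → Set
Finite A = ∃[ n ] (A ↔ Fin n)

------------------------------------------------------------------------
-- P/T nets

-- The raw data (P, T, Pre, Post); finiteness of P and T, which makes Pre
-- and Post |P| × |T| matrices, is required by IsPTNet.
record NetStructure : Set₁ where
  constructor ⟨_,_,_,_⟩
  field
    Place      : Set
    Transition : Set
    Pre        : Place → Transition → ℕ
    Post       : Place → Transition → ℕ

record IsPTNet (N : NetStructure) : Set where
  open NetStructure N
  field
    places-finite      : Finite Place
    transitions-finite : Finite Transition

Marking : NetStructure → Set
Marking N = NetStructure.Place N → ℕ

record PTSystem : Set₁ where
  field
    net     : NetStructure
    isPTNet : IsPTNet net
    m₀      : Marking net

  structure : ∃ Marking
  structure = net , m₀

------------------------------------------------------------------------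
-- PEPA models

-- Compositions of sequential components with d local derivatives and a
-- activities.  A leaf is one sequential component in a given local
-- derivative; P ⋈[ L ] Q is cooperation over L, and pure parallel
-- composition is the case L = ∅.
infix 5 _⋈[_]_
data Composition (d a : ℕ) : Set where
  ⟪_⟫    : Fin d → Composition d a
  _⋈[_]_ : Composition d a → Subset a → Composition d a → Composition d a

module _ {d a : ℕ} where

  components : Composition d a → List (Fin d)
  components ⟪ U ⟫        = [ U ]
  components (P ⋈[ L ] Q) = components P ++ components Q

  cooperating : Composition d a → Subset a
  cooperating ⟪ U ⟫        = ∅
  cooperating (P ⋈[ L ] Q) = L ∪ (cooperating P ∪ cooperating Q)

  vectorForm : Composition d a → Fin d → ℕ
  vectorForm P U = length (filter (U ≟_) (components P))

record PEPAModel : Set where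
  field
    #types       : ℕ
    #derivatives : ℕ
    #activities  : ℕ

  𝒟 : Set
  𝒟 = Fin #derivatives

  -- An activity is identified by its action type; rates play no role here.
  Activity : Set
  Activity = Fin #activities

  State : Set
  State = Composition #derivatives #activities

  field
    typeOf     : 𝒟 → Fin #types
    transition : 𝒟 → Activity → 𝒟 → Bool

  infix 4 _—[_]→_
  _—[_]→_ : 𝒟 → Activity → 𝒟 → Set
  U —[ l ]→ V = T (transition U l V)

  field
    type-preserving : ∀ {U l V} → U —[ l ]→ V → typeOf U ≡ typeOf V
    start           : State

  -- Since cooperation sets never change, the start determines the kind of an
  -- activity in every state.
  Shared : Activity → Set
  Shared l = l ∈ cooperating start

  Individual : Activity → Set
  Individual l = l ∉ cooperating start

  Post : 𝒟 → Activity → Set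
  Post U l = ∃[ V ] (U —[ l ]→ V)

  Enables : Activity → 𝒟 → Set
  Enables l U = Post U l

  field
    shared-distinct-types : ∀ {l U U′} → Shared l →
      Enables l U → Enables l U′ → U ≢ U′ → typeOf U ≢ typeOf U′

  enables? : ∀ l U → Dec (Enables l U)
  enables? l U = any? λ V → T? (transition U l V)

  -- The elements U₁ , … , Uₖ of pre(l), each listed once.
  pre : Activity → List 𝒟
  pre l = filter (enables? l) (allFin #derivatives)

  infix 4 _⟿[_]_ _⟿_
  data _⟿[_]_ : State → Activity → State → Set where
    component : ∀ {U l V} → U —[ l ]→ V → ⟪ U ⟫ ⟿[ l ] ⟪ V ⟫
    left  : ∀ {P P′ Q L l} → l ∉ L → P ⟿[ l ] P′ →
            P ⋈[ L ] Q ⟿[ l ] P′ ⋈[ L ] Q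
    right : ∀ {P Q Q′ L l} → l ∉ L → Q ⟿[ l ] Q′ →
            P ⋈[ L ] Q ⟿[ l ] P ⋈[ L ] Q′
    both  : ∀ {P P′ Q Q′ L l} → l ∈ L → P ⟿[ l ] P′ → Q ⟿[ l ] Q′ →
            P ⋈[ L ] Q ⟿[ l ] P′ ⋈[ L ] Q′

  _⟿_ : State → State → Set
  P ⟿ Q = ∃[ l ] (P ⟿[ l ] Q)

  Reachable : State → Set
  Reachable = Star _⟿_ start

  IsState : (𝒟 → ℕ) → Set
  IsState m = ∃[ P ] (Reachable P × m ≗ vectorForm P)

  -- The argument of type All is a tuple (V₁ , … , Vₖ) in
  -- post(U₁,l) × ⋯ × post(Uₖ,l).  The kind proofs are irrelevant, so
  -- labelled activities are distinguished by l and U → V (or w) alone.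
  data 𝒜label : Set where
    individual : ∀ l → .(Individual l) → ∀ {U V} → U —[ l ]→ V → 𝒜label
    shared     : ∀ l → .(Shared l) → All (λ U → Post U l) (pre l) → 𝒜label

  preₗ postₗ : 𝒜label → List 𝒟
  preₗ (individual _ _ {U} _)      = [ U ]
  preₗ (shared l _ _)              = pre l
  postₗ (individual _ _ {V = V} _) = [ V ]
  postₗ (shared _ _ w)             = All.reduce proj₁ w

  open DecMembership (_≟_ {#derivatives}) using (_∈?_)

  Cᴾʳᵉ Cᴾᵒˢᵗ : 𝒟 → 𝒜label → ℕ
  Cᴾʳᵉ  U α = if does (U ∈? preₗ α)  then 1 else 0
  Cᴾᵒˢᵗ U α = if does (U ∈? postₗ α) then 1 else 0

{-# OPTIONS --safe #-}
module Submission where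

-- Only the finiteness of 𝒜label needs an argument.  Over an activity l, the
-- labels form a finite sum of decidable propositions (l individual), or a
-- product of such sums over the finite list pre l (l shared).

open import Defs
open import Data.Bool.Properties using (T?; T-irrelevant)
open import Data.Fin using (Fin; zero; suc)
open import Data.Fin.Properties using (+↔⊎; *↔×)
open import Data.Fin.Subset.Properties using (_∈?_)
open import Data.Irrelevant using (Irrelevant; [_])
open import Data.List using ([]; _∷_)
open import Data.List.Relation.Unary.All using (All; []; _∷_; uncons)
open import Data.Nat using (ℕ; zero; suc)
open import Data.Product using (Σ; Σ-syntax; _×_; _,_; uncurry)
open import Data.Product.Function.NonDependent.Propositional using (_×-↔_)
open import Data.Sum using (_⊎_; inj₁; inj₂)
open import Data.Sum.Function.Propositional using (_⊎-↔_)
open import Function.Bundles using (_↔_; mk↔ₛ′)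
open import Function.Construct.Composition using (_↔-∘_)
open import Function.Construct.Identity using (↔-id)
open import Function.Construct.Symmetry using (↔-sym)
open import Relation.Binary.PropositionalEquality using (_≡_; _≗_; refl)
open import Relation.Nullary using (Dec; yes; no; ¬_; ¬?; contradiction; contradiction-irr)
import Relation.Nullary as Nullary

Finite-↔ : {A B : Set} → A ↔ B → Finite B → Finite A
Finite-↔ A↔B (n , B↔n) = n , (B↔n ↔-∘ A↔B)

Finite-⊎ : {A B : Set} → Finite A → Finite B → Finite (A ⊎ B)
Finite-⊎ (m , A↔m) (n , B↔n) = _ , (↔-sym +↔⊎ ↔-∘ (A↔m ⊎-↔ B↔n))

Finite-× : {A B : Set} → Finite A → Finite B → Finite (A × B)
Finite-× (m , A↔m) (n , B↔n) = _ , (↔-sym *↔× ↔-∘ (A↔m ×-↔ B↔n))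

Finite-Fin : ∀ n → Finite (Fin n)
Finite-Fin n = n , ↔-id (Fin n)

Finite-empty : {A : Set} → ¬ A → Finite A
Finite-empty ¬a = 0 , mk↔ₛ′ (λ a → contradiction a ¬a) (λ ()) (λ ()) (λ a → contradiction a ¬a)

Finite-contractible : {A : Set} (a : A) → (∀ b → a ≡ b) → Finite A
Finite-contractible a a≡ = 1 , mk↔ₛ′ (λ _ → zero) (λ _ → a) (λ { zero → refl }) a≡

Finite-prop : {A : Set} → Dec A → Nullary.Irrelevant A → Finite A
Finite-prop (yes a) irr = Finite-contractible a (irr a)
Finite-prop (no ¬a) irr = Finite-empty ¬a

-- Any two boxes are definitionally equal, so there is exactly one as soon as `A` is inhabited,
-- however many proofs `A` has.
Finite-Irrelevant : {A : Set} → Dec A → Finite (Irrelevant A)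
Finite-Irrelevant (yes a) = Finite-contractible [ a ] (λ _ → refl)
-- The unboxed proof may occur only in irrelevant positions, which `contradiction-irr` accepts.
Finite-Irrelevant (no ¬a) = Finite-empty λ { ([ a ]) → contradiction-irr a ¬a }

-- Induction on `n`, splitting off the fibre over `zero`; the fibres may differ in size, so a plain
-- product would not do.
Finite-Σ : ∀ n {B : Fin n → Set} → (∀ i → Finite (B i)) → Finite (Σ (Fin n) B)
Finite-Σ zero    fin = Finite-empty λ ()
Finite-Σ (suc n) {B} fin =
  Finite-↔ split (Finite-⊎ (fin zero) (Finite-Σ n (λ i → fin (suc i))))
  where
  split : Σ (Fin (suc n)) B ↔ (B zero ⊎ (Σ[ i ∈ Fin n ] B (suc i)))
  split = mk↔ₛ′
    (λ { (zero , b) → inj₁ b ; (suc i , b) → inj₂ (i , b) })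
    (λ { (inj₁ b) → zero , b ; (inj₂ (i , b)) → suc i , b })
    (λ { (inj₁ _) → refl ; (inj₂ _) → refl })
    (λ { (zero , _) → refl ; (suc _ , _) → refl })

Finite-All : {A : Set} {P : A → Set} → (∀ x → Finite (P x)) → ∀ xs → Finite (All P xs)
-- The empty tuple counts as one element: a shared `l` with empty `pre l` still carries one label.
Finite-All fin [] = Finite-contractible [] λ { [] → refl }
Finite-All fin (x ∷ xs) = Finite-↔
  (mk↔ₛ′ uncons (uncurry _∷_) (λ _ → refl) (λ { (_ ∷ _) → refl }))
  (Finite-× (fin x) (Finite-All fin xs))

module _ (M : PEPAModel) where
  open PEPAModel M

  -- A transition is `T` of a Boolean, so each target `V` contributes at most one element.
  Finite-Post : ∀ l U → Finite (Post U l)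
  Finite-Post l U = Finite-Σ #derivatives λ V → Finite-prop (T? (transition U l V)) T-irrelevant

  -- The fibre of `𝒜label` over `l`. The boxes mirror the irrelevant kind arguments of the
  -- constructors; unboxed proofs could not be recovered from a label.
  LabelsOf : Activity → Set
  LabelsOf l = (Irrelevant (Individual l) × (Σ[ U ∈ 𝒟 ] Post U l))
             ⊎ (Irrelevant (Shared l) × All (λ U → Post U l) (pre l))

  𝒜label↔ΣLabelsOf : 𝒜label ↔ Σ Activity LabelsOf
  𝒜label↔ΣLabelsOf = mk↔ₛ′
    (λ { (individual l i {U} {V} t) → l , inj₁ ([ i ] , U , V , t)
       ; (shared l s w)             → l , inj₂ ([ s ] , w) })
    (λ { (l , inj₁ ([ i ] , U , V , t)) → individual l i t
       ; (l , inj₂ ([ s ] , w))         → shared l s w })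
    -- Splitting on the summand is enough: eta for pairs and boxes does the rest.
    (λ { (l , inj₁ _) → refl ; (l , inj₂ _) → refl })
    (λ { (individual _ _ _) → refl ; (shared _ _ _) → refl })

  Finite-𝒜label : Finite 𝒜label
  Finite-𝒜label = Finite-↔ 𝒜label↔ΣLabelsOf (Finite-Σ #activities λ l →
    -- One membership test decides both kinds, so exactly one of the two summands has an inhabited
    -- box.
    let shared? = l ∈? cooperating start in
    Finite-⊎
      (Finite-× (Finite-Irrelevant (¬? shared?)) (Finite-Σ #derivatives (Finite-Post l)))
      (Finite-× (Finite-Irrelevant shared?) (Finite-All (Finite-Post l) (pre l))))

theorem1 : (M : PEPAModel) → let open PEPAModel M in
    let 𝒩 = ⟨ 𝒟 , 𝒜label , Cᴾʳᵉ , Cᴾᵒˢᵗ ⟩ in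
    (Σ[ S ∈ PTSystem ] PTSystem.structure S ≡ (𝒩 , vectorForm start))
    × (∀ (m : 𝒟 → ℕ) → IsState m → Σ[ μ ∈ Marking 𝒩 ] μ ≗ m)
theorem1 M =
  (record
    { net     = ⟨ 𝒟 , 𝒜label , Cᴾʳᵉ , Cᴾᵒˢᵗ ⟩
    ; isPTNet = record
      { places-finite      = Finite-Fin #derivatives
      ; transitions-finite = Finite-𝒜label M
      }
    ; m₀      = vectorForm start
    } , refl)
  -- `Marking` unfolds to `𝒟 → ℕ` here, so a state vector is itself the marking.
  , λ m _ → m , λ _ → refl
  where open PEPAModel M
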